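{- For every $n\ge 4$, $$h_3(n,\{(4,0),(4,1),(4,3)\}) = \begin{cases} \dfrac{n}{2} & \text{if } n\equiv 0 \pmod 6,\\[2mm] \left\lceil \dfrac{n+1}{2}\right\rceil & \text{if } n\not\equiv 0 \pmod 6.\end{cases}$$
   Context: For an $r$-uniform hypergraph ($r$-graph) $H$, a homogeneous set is a set of vertices that is either a clique (every $r$-subset is an edge) or a coclique (no $r$-subset is an edge); $h(H)$ denotes the size of a largest homogeneous set. An $(m,f)$-graph is an $r$-graph with $m$ vertices and $f$ edges; $H$ is $(m,f)$-free if it contains no induced sub-hypergraph that is an $(m,f)$-graph. For a set $Q$ of pairs $(m,f)$, $H$ is $Q$-free if it is $(m,f)$-free for every $(m,f)\in Q$. $h_r(n,Q)$ is the minimum of $h(H)$ over all $n$-vertex $Q$-free $r$-graphs $H$. -}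

module Defs where

open import Data.Bool using (Bool; true; false; T; T?)
open import Data.Fin.Subset using (Subset; inside; outside; ∣_∣; _⊆_)
open import Data.Fin.Subset.Properties using (_⊆?_)
open import Data.List using (List; []; _∷_; _++_; map; filter; length)
open import Data.List.Extrema.Nat using (max)
open import Data.List.Membership.Propositional using (_∈_)
open import Data.List.Membership.Propositional.Properties using (∈-map⁺; ∈-++⁺ˡ; ∈-++⁺ʳ)
open import Data.List.Relation.Unary.All using (all?; lookup; universal)
open import Data.List.Relation.Unary.Any using (here)
open import Data.Nat using (ℕ; zero; suc; _≤_; _≟_)
open import Data.Product using (_×_; _,_; Σ-syntax)
open import Data.Sum using (_⊎_)
import Data.Vec as Vec
open import Level using (0ℓ)
open import Relation.Binary.PropositionalEquality using (_≡_; refl)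
open import Relation.Nullary using (Dec; ¬_; ¬?; map′; _×-dec_; _⊎-dec_; _→-dec_)
open import Relation.Unary using (Pred; Decidable)

-- Every subset of Fin n, each listed exactly once.
subsets : ∀ n → List (Subset n)
subsets zero    = Vec.[] ∷ []
subsets (suc n) = map (inside Vec.∷_) (subsets n) ++ map (outside Vec.∷_) (subsets n)

∈-subsets : ∀ {n} (S : Subset n) → S ∈ subsets n
∈-subsets Vec.[]            = here refl
∈-subsets (true  Vec.∷ S)   = ∈-++⁺ˡ (∈-map⁺ (inside Vec.∷_) (∈-subsets S))
∈-subsets (false Vec.∷ S)   =
  ∈-++⁺ʳ (map (inside Vec.∷_) (subsets _)) (∈-map⁺ (outside Vec.∷_) (∈-subsets S))

allSubsets? : ∀ {n} {P : Pred (Subset n) 0ℓ} → Decidable P → Dec (∀ S → P S)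
allSubsets? P? =
  map′ (λ ps S → lookup ps (∈-subsets S)) (λ p → universal p _) (all? P? (subsets _))

record RGraph (r n : ℕ) : Set where
  field
    isEdge  : Subset n → Bool
    uniform : ∀ e → T (isEdge e) → ∣ e ∣ ≡ r

  Edge : Subset n → Set
  Edge e = T (isEdge e)

  Edge? : Decidable Edge
  Edge? e = T? (isEdge e)

module _ {r n : ℕ} (H : RGraph r n) where
  open RGraph H

  Clique : Subset n → Set
  Clique S = ∀ e → ∣ e ∣ ≡ r → e ⊆ S → Edge e

  Coclique : Subset n → Set
  Coclique S = ∀ e → ∣ e ∣ ≡ r → e ⊆ S → ¬ Edge e

  Homogeneous : Subset n → Set
  Homogeneous S = Clique S ⊎ Coclique S

  homogeneous? : Decidable Homogeneous
  homogeneous? S =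
    allSubsets? (λ e → (∣ e ∣ ≟ r) →-dec ((e ⊆? S) →-dec Edge? e))
      ⊎-dec
    allSubsets? (λ e → (∣ e ∣ ≟ r) →-dec ((e ⊆? S) →-dec ¬? (Edge? e)))

  -- The default 0 of max is harmless: the list is never empty, since the
  -- empty set is always homogeneous.
  h : ℕ
  h = max 0 (map ∣_∣ (filter homogeneous? (subsets n)))

  -- Number of edges of the sub-hypergraph induced on S.
  inducedEdges : Subset n → ℕ
  inducedEdges S = length (filter (λ e → (e ⊆? S) ×-dec Edge? e) (subsets n))

  Free : ℕ × ℕ → Set
  Free (m , f) = ∀ S → ¬ (∣ S ∣ ≡ m × inducedEdges S ≡ f)

  QFree : Pred (ℕ × ℕ) 0ℓ → Set
  QFree Q = ∀ mf → Q mf → Free mf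

IsMinimum : Pred ℕ 0ℓ → Pred ℕ 0ℓ
IsMinimum P k = P k × (∀ j → P j → k ≤ j)

-- h[ r ] n , Q ≔ k  says that h_r(n, Q) is defined and equal to k: the minimum
-- over a class of r-graphs exists only if that class is nonempty, so h_r(n, Q)
-- is rendered as a (functional) relation.
infix 4 h[_]_,_≔_
h[_]_,_≔_ : ℕ → ℕ → Pred (ℕ × ℕ) 0ℓ → ℕ → Set
h[ r ] n , Q ≔ k = IsMinimum (λ j → Σ[ H ∈ RGraph r n ] (QFree H Q × h H ≡ j)) k

{-# OPTIONS --safe #-}
module Submission where

-- The hypothesis says that every four vertices span two or four edges.  Such an H is determined
-- by a graph G with an isolated vertex o: ab is an edge of G iff oab is not an edge of H, and a
-- triple is an edge of H iff it contains an even number of edges of G.  Moreover G is free of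
-- triangles and of induced 2K₂.
--
-- Lower bound.  If G is bipartite, either colour class together with o is a clique of H, and the
-- two cliques share only o, so the larger one has more than n/2 vertices.  Otherwise G contains
-- a pentagon, and then every vertex is a twin of o or of a vertex of the pentagon: G is a blow-up
-- of C₅ + K₁.  Ten unions of three of the six classes are cliques of H, and each class lies in
-- five of them, so their average size is n/2; if none is larger than n/2, all classes are equal
-- and 6 divides n.
--
-- Upper bound.  If 6 divides n, take the balanced blow-up of C₅ + K₁.  Otherwise give the
-- vertices 0, …, n-1 alternating signs and let a triple be an edge iff its sign sequence does not
-- alternate.

open import Defs
open import Data.List using ([]; _∷_)
open import Data.List.Membership.Propositional using (_∈_)
open import Data.Nat using (ℕ; _+_; _≤_; ⌈_/2⌉)
open import Data.Nat.DivMod using (_/_; _%_)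
open import Data.Product using (_×_; _,_)
open import Relation.Binary.PropositionalEquality using (_≡_; _≢_)

open import Data.Bool using (Bool; true; false; T; T?; not; _∧_; _xor_; if_then_else_)
import Data.Bool.Properties as Bool
open import Data.Empty using (⊥; ⊥-elim)
open import Data.Fin using (Fin; zero; suc)
open import Data.Fin.Properties using (all?; any?) renaming (_≟_ to _≟ᶠ_)
open import Data.Fin.Subset using (Subset; inside; outside; ∣_∣; _⊆_; ⁅_⁆; _∪_)
  renaming (_∈_ to _∈ˢ_; _∉_ to _∉ˢ_; ⊥ to ∅)
open import Data.Fin.Subset.Properties
  using (_∈?_; _⊆?_; drop-∷-⊆; out⊆; in⊆in; ⊥⊆; ∉⊥; x∈⁅x⁆; x∈⁅y⁆⇒x≡y; p⊆p∪q; q⊆p∪q; x∈p∪q⁻;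
         ∪-identityˡ; ∪-assoc; ∪-comm; ∣⊥∣≡0; ∣⁅x⁆∣≡1; ∣p∣≤n; p⊆q⇒∣p∣≤∣q∣)
open import Data.List using (List; _++_; map; filter; length)
open import Data.List.Extrema.Nat using (max≤v⁺; v≤max⁺)
open import Data.List.Membership.Propositional using (find)
open import Data.List.Membership.Propositional.Properties using (∈-map⁺; ∈-filter⁺)
open import Data.List.Properties using (length-++; filter-++; filter-none)
open import Data.List.Relation.Unary.All as All using (All; []; _∷_)
import Data.List.Relation.Unary.All.Properties as All
open import Data.List.Relation.Unary.AllPairs using ([]; _∷_)
open import Data.List.Relation.Unary.Any as Any using (here; there)
open import Data.List.Relation.Unary.Unique.Propositional using (Unique)
open import Data.Nat
  using (zero; suc; _*_; _<_; z≤n; s≤s; _≡ᵇ_; _≟_; _≤?_; _<?_; ⌊_/2⌋)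
open import Data.Nat.DivMod using (m*n%n≡0; m≡m%n+[m/n]*n; m*n/n≡m)
open import Data.Nat.ListAction using () renaming (sum to sumˡ)
open import Data.Nat.Properties
open import Data.Nat.Tactic.RingSolver using (solve-∀)
open import Data.Product using (∃-syntax; proj₁; proj₂)
open import Data.Sum using (_⊎_; inj₁; inj₂)
open import Data.Vec as Vec using (Vec; []; _∷_; lookup; tabulate; replicate; sum; toList; updateAt)
open import Data.Vec.Properties using (≡-dec; lookup∘tabulate; []=⇒lookup; lookup⇒[]=)
open import Function using (_∘_)
open import Function.Bundles using (Equivalence)
open import Level using (0ℓ)
open import Relation.Binary.PropositionalEquality
  using (refl; sym; trans; cong; cong₂; subst; subst₂; ≢-sym; module ≡-Reasoning)
open import Relation.Nullary
  using (¬_; Dec; yes; no; does; ¬?; _×-dec_; _⊎-dec_; _→-dec_; contradiction)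
open import Relation.Nullary.Decidable using (True; isYes; toWitness; fromWitness)
open import Relation.Unary using (Pred; Decidable)

private variable
  n k : ℕ
  C : Set

-- Counting the edges inside a set

b2n : Bool → ℕ
b2n true  = 1
b2n false = 0

-- inducedEdges H S is count⊆ (RGraph.isEdge H) S by definition.
count⊆ : (Subset n → Bool) → Subset n → ℕ
count⊆ P S = length (filter (λ e → (e ⊆? S) ×-dec T? (P e)) (subsets _))

length-filter-map : {A B : Set} {P : Pred A 0ℓ} {Q : Pred B 0ℓ}
  (P? : Decidable P) (Q? : Decidable Q) (f : A → B) →
  (∀ x → Q (f x) → P x) → (∀ x → P x → Q (f x)) →
  ∀ xs → length (filter Q? (map f xs)) ≡ length (filter P? xs)
length-filter-map P? Q? f to from [] = refl
length-filter-map P? Q? f to from (x ∷ xs) with Q? (f x) | P? x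
... | yes _ | yes _ = cong suc (length-filter-map P? Q? f to from xs)
... | no _  | no _  = length-filter-map P? Q? f to from xs
... | yes q | no ¬p = contradiction (to x q) ¬p
... | no ¬q | yes p = contradiction (from x p) ¬q

length-filter-none : {A B : Set} {Q : Pred B 0ℓ} (Q? : Decidable Q) (f : A → B) →
  (∀ x → Q (f x) → ⊥) → ∀ xs → length (filter Q? (map f xs)) ≡ 0
length-filter-none Q? f no! [] = refl
length-filter-none Q? f no! (x ∷ xs) with Q? (f x)
... | yes q = contradiction q (no! x)
... | no _  = length-filter-none Q? f no! xs

length-filter-++ : {A : Set} {P : Pred A 0ℓ} (P? : Decidable P) (xs ys : List A) →
  length (filter P? (xs ++ ys)) ≡ length (filter P? xs) + length (filter P? ys)
length-filter-++ P? xs ys =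
  trans (cong length (filter-++ P? xs ys)) (length-++ (filter P? xs))

count⊆-outside : (P : Subset (suc n) → Bool) (S : Subset n) →
  count⊆ P (outside ∷ S) ≡ count⊆ (P ∘ (outside ∷_)) S
count⊆-outside {n} P S =
  trans (length-filter-++ _ (map (inside ∷_) (subsets n)) _)
    (cong₂ _+_
      (length-filter-none _ (inside ∷_) (λ e (e⊆S , _) → contradiction (e⊆S Vec.here) λ ()) (subsets n))
      (length-filter-map _ _ (outside ∷_)
        (λ e (e⊆S , Pe) → drop-∷-⊆ e⊆S , Pe)
        (λ e (e⊆S , Pe) → out⊆ e⊆S , Pe) (subsets n)))

count⊆-inside : (P : Subset (suc n) → Bool) (S : Subset n) →
  count⊆ P (inside ∷ S) ≡ count⊆ (P ∘ (inside ∷_)) S + count⊆ (P ∘ (outside ∷_)) S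
count⊆-inside {n} P S =
  trans (length-filter-++ _ (map (inside ∷_) (subsets n)) _)
    (cong₂ _+_
      (length-filter-map _ _ (inside ∷_)
        (λ e (e⊆S , Pe) → drop-∷-⊆ e⊆S , Pe)
        (λ e (e⊆S , Pe) → in⊆in e⊆S , Pe) (subsets n))
      (length-filter-map _ _ (outside ∷_)
        (λ e (e⊆S , Pe) → drop-∷-⊆ e⊆S , Pe)
        (λ e (e⊆S , Pe) → out⊆ e⊆S , Pe) (subsets n)))

count⊆-∅ : (P : Subset n → Bool) → count⊆ P ∅ ≡ b2n (P ∅)
count⊆-∅ {zero} P with P []
... | true  = refl
... | false = refl
count⊆-∅ {suc n} P = trans (count⊆-outside P ∅) (count⊆-∅ (P ∘ (outside ∷_)))

-- The predicates agree only pointwise, so `cong` does not apply; induction on `S` does the work of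
-- function extensionality.
count⊆-cong : {P Q : Subset n → Bool} → (∀ e → P e ≡ Q e) → ∀ S → count⊆ P S ≡ count⊆ Q S
count⊆-cong {zero} {P} {Q} P≗Q [] =
  trans (count⊆-∅ P) (trans (cong b2n (P≗Q [])) (sym (count⊆-∅ Q)))
count⊆-cong {suc n} {P} {Q} P≗Q (outside ∷ S) = begin
  count⊆ P (outside ∷ S)       ≡⟨ count⊆-outside P S ⟩
  count⊆ (P ∘ (outside ∷_)) S  ≡⟨ count⊆-cong (λ e → P≗Q _) S ⟩
  count⊆ (Q ∘ (outside ∷_)) S  ≡⟨ count⊆-outside Q S ⟨
  count⊆ Q (outside ∷ S)       ∎
  where open ≡-Reasoning
count⊆-cong {suc n} {P} {Q} P≗Q (inside ∷ S) = begin
  count⊆ P (inside ∷ S)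
    ≡⟨ count⊆-inside P S ⟩
  count⊆ (P ∘ (inside ∷_)) S + count⊆ (P ∘ (outside ∷_)) S
    ≡⟨ cong₂ _+_ (count⊆-cong (λ e → P≗Q _) S) (count⊆-cong (λ e → P≗Q _) S) ⟩
  count⊆ (Q ∘ (inside ∷_)) S + count⊆ (Q ∘ (outside ∷_)) S
    ≡⟨ count⊆-inside Q S ⟨
  count⊆ Q (inside ∷ S) ∎
  where open ≡-Reasoning

-- Split by membership of `a`: the subsets containing `a` arise once each by adding `a` to a subset
-- of `S`. The induction moves along the vertices until it reaches `a`.
count⊆-∪ : (P : Subset n → Bool) (a : Fin n) (S : Subset n) → a ∉ˢ S →
  count⊆ P (⁅ a ⁆ ∪ S) ≡ count⊆ (P ∘ (⁅ a ⁆ ∪_)) S + count⊆ P S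
count⊆-∪ P zero (inside ∷ S) a∉S = contradiction Vec.here a∉S
count⊆-∪ P zero (outside ∷ S) a∉S = begin
  count⊆ P (inside ∷ ∅ ∪ S)
    ≡⟨ cong (λ s → count⊆ P (inside ∷ s)) (∪-identityˡ S) ⟩
  count⊆ P (inside ∷ S)
    ≡⟨ count⊆-inside P S ⟩
  count⊆ (P ∘ (inside ∷_)) S + count⊆ (P ∘ (outside ∷_)) S
    ≡⟨ cong (_+ count⊆ (P ∘ (outside ∷_)) S)
         (count⊆-cong (λ e → cong (λ s → P (inside ∷ s)) (sym (∪-identityˡ e))) S) ⟩
  count⊆ (λ e → P (inside ∷ ∅ ∪ e)) S + count⊆ (P ∘ (outside ∷_)) S
    ≡⟨ cong₂ _+_ (count⊆-outside (P ∘ (⁅ zero ⁆ ∪_)) S) (count⊆-outside P S) ⟨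
  count⊆ (P ∘ (⁅ zero ⁆ ∪_)) (outside ∷ S) + count⊆ P (outside ∷ S) ∎
  where open ≡-Reasoning
count⊆-∪ P (suc a) (outside ∷ S) a∉S = begin
  count⊆ P (outside ∷ ⁅ a ⁆ ∪ S)
    ≡⟨ count⊆-outside P (⁅ a ⁆ ∪ S) ⟩
  count⊆ (P ∘ (outside ∷_)) (⁅ a ⁆ ∪ S)
    ≡⟨ count⊆-∪ _ a S (a∉S ∘ Vec.there) ⟩
  count⊆ (λ e → P (outside ∷ ⁅ a ⁆ ∪ e)) S + count⊆ (P ∘ (outside ∷_)) S
    ≡⟨ cong₂ _+_ (count⊆-outside (P ∘ (⁅ suc a ⁆ ∪_)) S) (count⊆-outside P S) ⟨
  count⊆ (P ∘ (⁅ suc a ⁆ ∪_)) (outside ∷ S) + count⊆ P (outside ∷ S) ∎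
  where open ≡-Reasoning
count⊆-∪ P (suc a) (inside ∷ S) a∉S = begin
  count⊆ P (inside ∷ ⁅ a ⁆ ∪ S)
    ≡⟨ count⊆-inside P (⁅ a ⁆ ∪ S) ⟩
  count⊆ (P ∘ (inside ∷_)) (⁅ a ⁆ ∪ S) + count⊆ (P ∘ (outside ∷_)) (⁅ a ⁆ ∪ S)
    ≡⟨ cong₂ _+_ (count⊆-∪ _ a S (a∉S ∘ Vec.there)) (count⊆-∪ _ a S (a∉S ∘ Vec.there)) ⟩
  (p + q) + (r + s)
    ≡⟨ interchange p q r s ⟩
  (p + r) + (q + s)
    ≡⟨ cong₂ _+_ (count⊆-inside (P ∘ (⁅ suc a ⁆ ∪_)) S) (count⊆-inside P S) ⟨
  count⊆ (P ∘ (⁅ suc a ⁆ ∪_)) (inside ∷ S) + count⊆ P (inside ∷ S) ∎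
  where
  open ≡-Reasoning
  p = count⊆ (λ e → P (inside ∷ ⁅ a ⁆ ∪ e)) S
  q = count⊆ (P ∘ (inside ∷_)) S
  r = count⊆ (λ e → P (outside ∷ ⁅ a ⁆ ∪ e)) S
  s = count⊆ (P ∘ (outside ∷_)) S
  interchange : ∀ p q r s → (p + q) + (r + s) ≡ (p + r) + (q + s)
  interchange = solve-∀

-- Common target of `count⊆-fromList` and `count⊆-word`: for four vertices, a count over all subsets
-- of `Fin n` becomes a sum of sixteen values.
subseqCount : (List C → Bool) → List C → ℕ
subseqCount f []       = b2n (f [])
subseqCount f (x ∷ xs) = subseqCount (f ∘ (x ∷_)) xs + subseqCount f xs

fromList : List (Fin n) → Subset n
fromList []       = ∅
fromList (x ∷ xs) = ⁅ x ⁆ ∪ fromList xs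

∈-fromList : {x : Fin n} {xs : List (Fin n)} → x ∈ xs → x ∈ˢ fromList xs
∈-fromList {x = x} (here refl) = p⊆p∪q _ (x∈⁅x⁆ x)
∈-fromList {xs = y ∷ ys} (there x∈) = q⊆p∪q ⁅ y ⁆ (fromList ys) (∈-fromList x∈)

∉-fromList : ∀ {x : Fin n} {xs} → All (x ≢_) xs → x ∉ˢ fromList xs
∉-fromList []           x∈ = ∉⊥ x∈
∉-fromList {x = x} {y ∷ ys} (x≢y ∷ x≢ys) x∈ with x∈p∪q⁻ ⁅ y ⁆ _ x∈
... | inj₁ x∈y  = x≢y (x∈⁅y⁆⇒x≡y y x∈y)
... | inj₂ x∈ys = ∉-fromList x≢ys x∈ys

count⊆-fromList : (P : Subset n → Bool) {xs : List (Fin n)} → Unique xs →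
  count⊆ P (fromList xs) ≡ subseqCount (P ∘ fromList) xs
count⊆-fromList P [] = count⊆-∅ P
count⊆-fromList P {x ∷ xs} (x≢xs ∷ xs!) =
  trans (count⊆-∪ P x (fromList xs) (∉-fromList x≢xs))
    (cong₂ _+_ (count⊆-fromList (P ∘ (⁅ x ⁆ ∪_)) xs!) (count⊆-fromList P xs!))

∣⁅x⁆∪p∣ : (x : Fin n) {p : Subset n} → x ∉ˢ p → ∣ ⁅ x ⁆ ∪ p ∣ ≡ suc ∣ p ∣
∣⁅x⁆∪p∣ zero {inside ∷ p} x∉p = contradiction Vec.here x∉p
∣⁅x⁆∪p∣ zero {outside ∷ p} x∉p = cong (suc ∘ ∣_∣) (∪-identityˡ p)
∣⁅x⁆∪p∣ (suc x) {inside ∷ p} x∉p = cong suc (∣⁅x⁆∪p∣ x (x∉p ∘ Vec.there))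
∣⁅x⁆∪p∣ (suc x) {outside ∷ p} x∉p = ∣⁅x⁆∪p∣ x (x∉p ∘ Vec.there)

∣fromList∣ : {xs : List (Fin n)} → Unique xs → ∣ fromList xs ∣ ≡ length xs
∣fromList∣ {n} [] = ∣⊥∣≡0 n
∣fromList∣ {xs = x ∷ xs} (x≢xs ∷ xs!) =
  trans (∣⁅x⁆∪p∣ x (∉-fromList x≢xs)) (cong suc (∣fromList∣ xs!))

∣S∣≡suc⇒ : ∀ {k} (S : Subset n) → ∣ S ∣ ≡ suc k →
  ∃[ x ] ∃[ p ] (x ∉ˢ p × ∣ p ∣ ≡ k × S ≡ ⁅ x ⁆ ∪ p)
∣S∣≡suc⇒ (inside ∷ S) refl =
  zero , outside ∷ S , (λ ()) , refl , cong (inside ∷_) (sym (∪-identityˡ S))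
∣S∣≡suc⇒ (outside ∷ S) eq with ∣S∣≡suc⇒ S eq
... | x , p , x∉p , ∣p∣ , S≡ =
  suc x , outside ∷ p , (λ { (Vec.there x∈p) → x∉p x∈p }) , ∣p∣ , cong (outside ∷_) S≡

elements-of-size : ∀ k (S : Subset n) → ∣ S ∣ ≡ k →
  ∃[ xs ] (Unique xs × length xs ≡ k × S ≡ fromList xs)
elements-of-size zero S ∣S∣ = [] , [] , refl , empty S ∣S∣
  where
  empty : ∀ {n} (S : Subset n) → ∣ S ∣ ≡ 0 → S ≡ ∅
  empty [] _ = refl
  empty (outside ∷ S) eq = cong (outside ∷_) (empty S eq)
elements-of-size (suc k) S ∣S∣ with ∣S∣≡suc⇒ S ∣S∣
... | x , p , x∉p , ∣p∣ , S≡ with elements-of-size k p ∣p∣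
... | xs , xs! , len , refl =
  x ∷ xs , All.¬Any⇒All¬ xs (x∉p ∘ ∈-fromList) ∷ xs! , cong suc len , S≡

-- Colours appear in increasing order of the vertices, so a predicate on words may depend on that
-- order, as the sign hypergraph requires.
word : (Fin n → C) → Subset n → List C
word κ []            = []
word κ (inside ∷ S)  = κ zero ∷ word (κ ∘ suc) S
word κ (outside ∷ S) = word (κ ∘ suc) S

length-word : (κ : Fin n → C) (S : Subset n) → length (word κ S) ≡ ∣ S ∣
length-word κ []            = refl
length-word κ (inside ∷ S)  = cong suc (length-word (κ ∘ suc) S)
length-word κ (outside ∷ S) = length-word (κ ∘ suc) S

count⊆-word : (κ : Fin n → C) (f : List C → Bool) (S : Subset n) →
  count⊆ (f ∘ word κ) S ≡ subseqCount f (word κ S)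
count⊆-word κ f [] = count⊆-∅ (f ∘ word κ)
count⊆-word κ f (inside ∷ S) =
  trans (count⊆-inside (f ∘ word κ) S)
    (cong₂ _+_ (count⊆-word (κ ∘ suc) (f ∘ (κ zero ∷_)) S) (count⊆-word (κ ∘ suc) f S))
count⊆-word κ f (outside ∷ S) =
  trans (count⊆-outside (f ∘ word κ) S) (count⊆-word (κ ∘ suc) f S)

-- The implicit argument is filled by evaluating the decision procedure, so a finite statement is
-- proved by exhaustive search.
from-true : {P : Set} (d : Dec P) {t : True d} → P
from-true d {t} = toWitness t

-- Triangle-free graphs without induced 2K₂

pattern v0 = zero
pattern v1 = suc zero
pattern v2 = suc (suc zero)
pattern v3 = suc (suc (suc zero))
pattern v4 = suc (suc (suc (suc zero)))
pattern v5 = suc (suc (suc (suc (suc zero))))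

-- The pentagon v0 v1 v2 v3 v4 together with the isolated vertex v5.
neighbours : Fin 6 → Subset 6
neighbours v0 = false ∷ true ∷ false ∷ false ∷ true ∷ false ∷ []
neighbours v1 = true ∷ false ∷ true ∷ false ∷ false ∷ false ∷ []
neighbours v2 = false ∷ true ∷ false ∷ true ∷ false ∷ false ∷ []
neighbours v3 = false ∷ false ∷ true ∷ false ∷ true ∷ false ∷ []
neighbours v4 = true ∷ false ∷ false ∷ true ∷ false ∷ false ∷ []
neighbours v5 = false ∷ false ∷ false ∷ false ∷ false ∷ false ∷ []

M : Fin 6 → Fin 6 → Bool
M i j = lookup (neighbours i) j

infix 4 _∼_ _≁_
_∼_ _≁_ : Fin 6 → Fin 6 → Set
i ∼ j = M i j ≡ true
i ≁ j = M i j ≡ false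

_∼?_ : ∀ i j → Dec (i ∼ j)
i ∼? j = M i j Bool.≟ true

_≁?_ : ∀ i j → Dec (i ≁ j)
i ≁? j = M i j Bool.≟ false

-- Abstract, since unfolding these exhaustive checks at open arguments is infeasible.
abstract
  -- Used to exclude chords: in a triangle-free graph two vertices with a common neighbour are not
  -- adjacent.
  M-chord : ∀ i j → i ≁ j → i ≡ v5 ⊎ j ≡ v5 ⊎ ∃[ k ] (i ∼ k × j ∼ k)
  M-chord = from-true (all? λ i → all? λ j → (i ≁? j) →-dec
    ((i ≟ᶠ v5) ⊎-dec (j ≟ᶠ v5) ⊎-dec any? λ k → (i ∼? k) ×-dec (j ∼? k)))

  -- b is the set of neighbours of a vertex on a pentagon; the last two cases give a triangle and
  -- an induced 2K₂.
  M-signature : ∀ (b : Subset 6) →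
    (∃[ i ] b ≡ neighbours i)
    ⊎ lookup b v5 ≡ true
    ⊎ (∃[ j ] ∃[ k ] (lookup b j ≡ true × lookup b k ≡ true × j ∼ k))
    ⊎ (∃[ j ] ∃[ k ] ∃[ l ] (lookup b j ≡ true × k ∼ l ×
         lookup b k ≡ false × lookup b l ≡ false × j ≁ k × j ≁ l))
  M-signature = from-true (allSubsets? λ b →
    any? (λ i → ≡-dec Bool._≟_ b (neighbours i))
    ⊎-dec (lookup b v5 Bool.≟ true)
    ⊎-dec any? (λ j → any? λ k →
            (lookup b j Bool.≟ true) ×-dec (lookup b k Bool.≟ true) ×-dec (j ∼? k))
    ⊎-dec any? (λ j → any? λ k → any? λ l → (lookup b j Bool.≟ true) ×-dec (k ∼? l) ×-dec
            (lookup b k Bool.≟ false) ×-dec (lookup b l Bool.≟ false) ×-dec (j ≁? k) ×-dec (j ≁? l)))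

  -- Twins x of i and y of j with the wrong adjacency would form a triangle with k, or an induced
  -- 2K₂ from xy and kl or from xk and yl.
  M-forced : ∀ i j →
    (i ≁ j × ((∃[ k ] (i ∼ k × j ∼ k))
              ⊎ (∃[ k ] ∃[ l ] (k ∼ l × i ≁ k × i ≁ l × j ≁ k × j ≁ l))))
    ⊎ (i ∼ j × ∃[ k ] ∃[ l ] (i ∼ k × j ∼ l × i ≁ l × j ≁ k × k ≁ l))
  M-forced = from-true (all? λ i → all? λ j →
    ((i ≁? j) ×-dec (any? (λ k → (i ∼? k) ×-dec (j ∼? k))
       ⊎-dec any? λ k → any? λ l →
         (k ∼? l) ×-dec (i ≁? k) ×-dec (i ≁? l) ×-dec (j ≁? k) ×-dec (j ≁? l)))
    ⊎-dec ((i ∼? j) ×-dec any? λ k → any? λ l →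
       (i ∼? k) ×-dec (j ∼? l) ×-dec (i ≁? l) ×-dec (j ≁? k) ×-dec (k ≁? l)))

does-≡ : {P Q : Set} (P? : Dec P) (Q? : Dec Q) → does P? ≡ does Q? → (P × Q) ⊎ (¬ P × ¬ Q)
does-≡ (yes p) (yes q) _ = inj₁ (p , q)
does-≡ (no ¬p) (no ¬q) _ = inj₂ (¬p , ¬q)

module Graph (adj : Fin n → Fin n → Bool)
  (adj-sym : ∀ x y → adj x y ≡ adj y x)
  (triangle-free : ∀ x y z → adj x y ≡ true → adj y z ≡ true → adj x z ≡ true → ⊥)
  (2K₂-free : ∀ a b c d → adj a b ≡ true → adj c d ≡ true →
    adj a c ≡ false → adj a d ≡ false → adj b c ≡ false → adj b d ≡ false → ⊥)
  (o : Fin n) (o-isolated : ∀ x → adj o x ≡ false)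
  where

  flip : ∀ {x y b} → adj x y ≡ b → adj y x ≡ b
  flip {x} {y} eq = trans (adj-sym y x) eq

  true≢false : ∀ {b} → b ≡ true → b ≡ false → ⊥
  true≢false refl ()

  common⇒nonadjacent : ∀ {x y z} → adj x z ≡ true → adj y z ≡ true → adj x y ≡ false
  common⇒nonadjacent x∼z y∼z = Bool.¬-not λ x∼y → triangle-free _ _ _ x∼y y∼z x∼z

  -- Only a closed walk of length five; `c-induced` derives from triangle-freeness that it has no
  -- chords.
  IsPentagon : (c₀ c₁ c₂ c₃ c₄ : Fin n) → Set
  IsPentagon c₀ c₁ c₂ c₃ c₄ =
    adj c₀ c₁ ≡ true × adj c₁ c₂ ≡ true × adj c₂ c₃ ≡ true × adj c₃ c₄ ≡ true × adj c₄ c₀ ≡ true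

  pentagon? : Dec (∃[ c₀ ] ∃[ c₁ ] ∃[ c₂ ] ∃[ c₃ ] ∃[ c₄ ] IsPentagon c₀ c₁ c₂ c₃ c₄)
  pentagon? = any? λ c₀ → any? λ c₁ → any? λ c₂ → any? λ c₃ → any? λ c₄ →
    (adj c₀ c₁ Bool.≟ true) ×-dec (adj c₁ c₂ Bool.≟ true) ×-dec (adj c₂ c₃ Bool.≟ true)
      ×-dec (adj c₃ c₄ Bool.≟ true) ×-dec (adj c₄ c₀ Bool.≟ true)

  Proper : (Fin n → Bool) → Set
  Proper A = ∀ x y → adj x y ≡ true → A x ≢ A y

  -- For an edge uw, the sets N(u), N(w) and the rest R are independent.  Colour N(w) false, N(u)
  -- true, and a vertex of R true iff it has a neighbour in N(w); an edge between N(u) and a true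
  -- vertex of R closes a pentagon.
  bipartite-or-pentagon :
    (∃[ A ] Proper A) ⊎ (∃[ c₀ ] ∃[ c₁ ] ∃[ c₂ ] ∃[ c₃ ] ∃[ c₄ ] IsPentagon c₀ c₁ c₂ c₃ c₄)
  bipartite-or-pentagon with pentagon? | any? (λ u → any? λ w → adj u w Bool.≟ true)
  ... | yes p      | _ = inj₂ p
  ... | no _       | no no-edge = inj₁ ((λ _ → true) , λ x y x∼y _ → no-edge (x , y , x∼y))
  ... | no no-pent | yes (u , w , u∼w) = inj₁ (A , proper)
    where
    InA : Fin n → Set
    InA x = adj u x ≡ true ⊎ (adj w x ≡ false × ∃[ y ] (adj w y ≡ true × adj y x ≡ true))

    InA? : ∀ x → Dec (InA x)
    InA? x = (adj u x Bool.≟ true) ⊎-dec ((adj w x Bool.≟ false) ×-dec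
      any? λ y → (adj w y Bool.≟ true) ×-dec (adj y x Bool.≟ true))

    A : Fin n → Bool
    A x = does (InA? x)

    far : ∀ {x y} → adj x y ≡ true → ¬ (adj u x ≡ true) → ¬ (adj u y ≡ true) →
          adj w x ≡ false → adj w y ≡ false → ⊥
    far x∼y u≁x u≁y w≁x w≁y =
      2K₂-free _ _ _ _ u∼w x∼y (Bool.¬-not u≁x) (Bool.¬-not u≁y) w≁x w≁y

    -- The closed walk is u, x, y, z, w, with x in N(u) and z in N(w).
    pent : ∀ {x y} → adj x y ≡ true → adj u x ≡ true →
           ∃[ z ] (adj w z ≡ true × adj z y ≡ true) → ⊥
    pent x∼y u∼x (z , w∼z , z∼y) =
      no-pent (_ , _ , _ , _ , _ , u∼x , x∼y , flip z∼y , flip w∼z , flip u∼w)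

    both-in : ∀ {x y} → adj x y ≡ true → InA x → InA y → ⊥
    both-in x∼y (inj₁ u∼x) (inj₁ u∼y)      = triangle-free _ _ _ u∼x x∼y u∼y
    both-in x∼y (inj₁ u∼x) (inj₂ (_ , p))  = pent x∼y u∼x p
    both-in x∼y (inj₂ (_ , p)) (inj₁ u∼y)  = pent (flip x∼y) u∼y p
    -- The second alternative of `InA` does not exclude membership in N(u), so this is asked again.
    -- If neither x nor y lies in N(u), then uw and xy form an induced 2K₂.
    both-in {x} {y} x∼y (inj₂ (w≁x , p)) (inj₂ (w≁y , q))
      with adj u x Bool.≟ true | adj u y Bool.≟ true
    ... | yes u∼x | _       = pent x∼y u∼x q
    ... | no _    | yes u∼y = pent (flip x∼y) u∼y p
    ... | no u≁x  | no u≁y  = far x∼y u≁x u≁y w≁x w≁y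

    both-out : ∀ {x y} → adj x y ≡ true → ¬ InA x → ¬ InA y → ⊥
    both-out {x} {y} x∼y x∉A y∉A with adj w x in wx | adj w y in wy
    ... | true  | true  = triangle-free _ _ _ wx x∼y wy
    ... | true  | false = y∉A (inj₂ (refl , x , wx , x∼y))
    ... | false | true  = x∉A (inj₂ (refl , y , wy , flip x∼y))
    ... | false | false = far x∼y (x∉A ∘ inj₁) (y∉A ∘ inj₁) wx wy

    proper : Proper A
    proper x y x∼y Ax≡Ay with does-≡ (InA? x) (InA? y) Ax≡Ay
    ... | inj₁ (x∈A , y∈A) = both-in x∼y x∈A y∈A
    ... | inj₂ (x∉A , y∉A) = both-out x∼y x∉A y∉A

  module Pentagon (c₀ c₁ c₂ c₃ c₄ : Fin n) (pent : IsPentagon c₀ c₁ c₂ c₃ c₄) where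

    c : Fin 6 → Fin n
    c = lookup (c₀ ∷ c₁ ∷ c₂ ∷ c₃ ∷ c₄ ∷ o ∷ [])

    c-edge : ∀ i j → i ∼ j → adj (c i) (c j) ≡ true
    c-edge = let e₀₁ , e₁₂ , e₂₃ , e₃₄ , e₄₀ = pent in λ where
      v0 v1 _ → e₀₁
      v1 v0 _ → flip e₀₁
      v1 v2 _ → e₁₂
      v2 v1 _ → flip e₁₂
      v2 v3 _ → e₂₃
      v3 v2 _ → flip e₂₃
      v3 v4 _ → e₃₄
      v4 v3 _ → flip e₃₄
      v4 v0 _ → e₄₀
      v0 v4 _ → flip e₄₀
      v0 v5 ()
      v1 v3 ()
      v1 v4 ()
      v1 v5 ()
      v2 v4 ()
      v2 v5 ()
      v3 v5 ()
      v5 v0 ()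
      v4 v1 ()
      v5 v1 ()
      v4 v2 ()
      v5 v2 ()
      v5 v3 ()
      v4 v4 ()
      v4 v5 ()
      v5 v4 ()
      v5 v5 ()

    c-induced : ∀ i j → adj (c i) (c j) ≡ M i j
    c-induced i j with M i j in eq
    ... | true  = c-edge i j eq
    ... | false with M-chord i j eq
    ... | inj₁ refl        = o-isolated _
    ... | inj₂ (inj₁ refl) = flip (o-isolated _)
    ... | inj₂ (inj₂ (k , i∼k , j∼k)) = common⇒nonadjacent (c-edge i k i∼k) (c-edge j k j∼k)

    Sig : Fin n → Fin 6 → Set
    Sig x i = ∀ j → adj x (c j) ≡ M i j

    bits : Fin n → Subset 6
    bits x = tabulate λ j → adj x (c j)

    bit : ∀ {x} j {b} → lookup (bits x) j ≡ b → adj x (c j) ≡ b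
    bit {x} j = trans (sym (lookup∘tabulate (λ j → adj x (c j)) j))

    -- The other alternatives of `M-signature` contradict, in turn, the isolation of `o`,
    -- triangle-freeness and the absence of an induced 2K₂.
    signature : ∀ x → ∃[ i ] Sig x i
    signature x with M-signature (bits x)
    ... | inj₁ (i , eq) = i , λ j → bit j (cong (λ b → lookup b j) eq)
    ... | inj₂ (inj₁ x∼o) = ⊥-elim (true≢false (bit v5 x∼o) (flip (o-isolated x)))
    ... | inj₂ (inj₂ (inj₁ (j , k , x∼j , x∼k , j∼k))) = ⊥-elim
            (triangle-free _ _ _ (bit j x∼j) (c-edge j k j∼k) (bit k x∼k))
    ... | inj₂ (inj₂ (inj₂ (j , k , l , x∼j , k∼l , x≁k , x≁l , j≁k , j≁l))) = ⊥-elim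
            (2K₂-free _ _ _ _ (bit j x∼j) (c-edge k l k∼l) (bit k x≁k) (bit l x≁l)
               (trans (c-induced j k) j≁k) (trans (c-induced j l) j≁l))

    class : Fin n → Fin 6
    class x = proj₁ (signature x)

    -- By their signatures, x and y see the witnesses of `M-forced` as `c i` and `c j` do, so the
    -- opposite value of `adj x y` would complete an excluded configuration.
    adj-class : ∀ x y → adj x y ≡ M (class x) (class y)
    adj-class x y with signature x | signature y
    ... | i , sx | j , sy with M-forced i j
    ... | inj₁ (i≁j , inj₁ (k , i∼k , j∼k)) =
            trans (common⇒nonadjacent (trans (sx k) i∼k) (trans (sy k) j∼k)) (sym i≁j)
    ... | inj₁ (i≁j , inj₂ (k , l , k∼l , i≁k , i≁l , j≁k , j≁l)) =
            trans (Bool.¬-not λ x∼y → 2K₂-free _ _ _ _ x∼y (c-edge k l k∼l)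
              (trans (sx k) i≁k) (trans (sx l) i≁l) (trans (sy k) j≁k) (trans (sy l) j≁l)) (sym i≁j)
    ... | inj₂ (i∼j , k , l , i∼k , j∼l , i≁l , j≁k , k≁l) =
            trans (Bool.¬-not λ x≁y → 2K₂-free _ _ _ _ (trans (sx k) i∼k) (trans (sy l) j∼l)
              x≁y (trans (sx l) i≁l) (flip (trans (sy k) j≁k)) (trans (c-induced k l) k≁l))
              (sym i∼j)

-- The two-graph of a hypergraph

Forbidden : ℕ × ℕ → Set
Forbidden = _∈ ((4 , 0) ∷ (4 , 1) ∷ (4 , 3) ∷ [])

∣⁅x⁆∪p∣≤ : (x : Fin n) (p : Subset n) → ∣ ⁅ x ⁆ ∪ p ∣ ≤ suc ∣ p ∣
∣⁅x⁆∪p∣≤ zero (inside ∷ p) rewrite ∪-identityˡ p = n≤1+n _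
∣⁅x⁆∪p∣≤ zero (outside ∷ p) rewrite ∪-identityˡ p = ≤-refl
∣⁅x⁆∪p∣≤ (suc x) (inside ∷ p) = s≤s (∣⁅x⁆∪p∣≤ x p)
∣⁅x⁆∪p∣≤ (suc x) (outside ∷ p) = ∣⁅x⁆∪p∣≤ x p

∣fromList∣≤ : (xs : List (Fin n)) → ∣ fromList xs ∣ ≤ length xs
∣fromList∣≤ {n} [] = ≤-reflexive (∣⊥∣≡0 n)
∣fromList∣≤ (x ∷ xs) = ≤-trans (∣⁅x⁆∪p∣≤ x (fromList xs)) (s≤s (∣fromList∣≤ xs))

tripleSum : Bool → Bool → Bool → Bool → ℕ
tripleSum p q r s = b2n p + (b2n q + (b2n r + b2n s))

-- Of the sixteen sublists only the four of length three count; `arrange` removes the zeros that the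
-- others leave in the recursion.
subseqCount-triples : (f : List C → Bool) (a b c d : C) →
  (∀ w → length w ≤ 2 → f w ≡ false) → f (a ∷ b ∷ c ∷ d ∷ []) ≡ false →
  subseqCount f (a ∷ b ∷ c ∷ d ∷ []) ≡
    tripleSum (f (a ∷ b ∷ c ∷ [])) (f (a ∷ b ∷ d ∷ [])) (f (a ∷ c ∷ d ∷ [])) (f (b ∷ c ∷ d ∷ []))
subseqCount-triples f a b c d short long
  rewrite long
        | short (a ∷ b ∷ []) (s≤s (s≤s z≤n)) | short (a ∷ c ∷ []) (s≤s (s≤s z≤n))
        | short (a ∷ d ∷ []) (s≤s (s≤s z≤n)) | short (b ∷ c ∷ []) (s≤s (s≤s z≤n))
        | short (b ∷ d ∷ []) (s≤s (s≤s z≤n)) | short (c ∷ d ∷ []) (s≤s (s≤s z≤n))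
        | short (a ∷ []) (s≤s z≤n) | short (b ∷ []) (s≤s z≤n)
        | short (c ∷ []) (s≤s z≤n) | short (d ∷ []) (s≤s z≤n)
        | short [] z≤n =
  arrange (b2n (f (a ∷ b ∷ c ∷ []))) (b2n (f (a ∷ b ∷ d ∷ [])))
          (b2n (f (a ∷ c ∷ d ∷ []))) (b2n (f (b ∷ c ∷ d ∷ [])))
  where
  arrange : ∀ p q r s → ((p + (q + 0)) + ((r + 0) + (0 + 0))) + (((s + 0) + (0 + 0)) + ((0 + 0) + (0 + 0)))
                      ≡ p + (q + (r + s))
  arrange = solve-∀

TwoOrFour : ℕ → Set
TwoOrFour k = k ≡ 2 ⊎ k ≡ 4

twoOrFour? : ∀ k → Dec (TwoOrFour k)
twoOrFour? k = (k ≟ 2) ⊎-dec (k ≟ 4)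

-- A `Subset 4` serves as a vector of four Booleans, so that `allSubsets?` runs through all
-- assignments.
tripleSumˢ : Subset 4 → ℕ
tripleSumˢ S = tripleSum (lookup S v0) (lookup S v1) (lookup S v2) (lookup S v3)

abstract
  tripleSum-twoOrFour : ∀ p q r s → let k = tripleSum p q r s in
    k ≢ 0 → k ≢ 1 → k ≢ 3 → TwoOrFour k
  tripleSum-twoOrFour p q r s = from-true (allSubsets? λ S → let k = tripleSumˢ S in
    ¬? (k ≟ 0) →-dec ¬? (k ≟ 1) →-dec ¬? (k ≟ 3) →-dec twoOrFour? k) (p ∷ q ∷ r ∷ s ∷ [])

  -- p, q, r, s stand for the triples oxy, oxz, oyz and xyz.
  even⇒fourth : ∀ p q r s → TwoOrFour (tripleSum p q r s) → s ≡ not (not p xor (not r xor not q))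
  even⇒fourth p q r s = from-true (allSubsets? λ S → twoOrFour? (tripleSumˢ S) →-dec
    (lookup S v3 Bool.≟ not (not (lookup S v0) xor (not (lookup S v2) xor not (lookup S v1)))))
    (p ∷ q ∷ r ∷ s ∷ [])

∪-swap : (p q r : Subset n) → p ∪ (q ∪ r) ≡ q ∪ (p ∪ r)
∪-swap p q r = trans (sym (∪-assoc p q r)) (trans (cong (_∪ r) (∪-comm p q)) (∪-assoc q p r))

≡-not-not-xor-false : ∀ b → b ≡ not (not b xor false)
≡-not-not-xor-false true  = refl
≡-not-not-xor-false false = refl

odd : Bool → Bool → Bool → Bool
odd p q r = p xor (q xor r)

module TwoGraph {m} (H : RGraph 3 (suc m)) (free : QFree H Forbidden) where
  open RGraph H

  edge : Fin (suc m) → Fin (suc m) → Fin (suc m) → Bool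
  edge x y z = isEdge (fromList (x ∷ y ∷ z ∷ []))

  edge-swapˡ : ∀ x y z → edge x y z ≡ edge y x z
  edge-swapˡ x y z = cong isEdge (∪-swap ⁅ x ⁆ ⁅ y ⁆ _)

  edge-swapʳ : ∀ x y z → edge x y z ≡ edge x z y
  edge-swapʳ x y z = cong (λ e → isEdge (⁅ x ⁆ ∪ e)) (∪-swap ⁅ y ⁆ ⁅ z ⁆ _)

  nonedge : ∀ e → ∣ e ∣ ≢ 3 → isEdge e ≡ false
  nonedge e ∣e∣≢3 with isEdge e in eq
  ... | true  = contradiction (uniform e (subst T (sym eq) _)) ∣e∣≢3
  ... | false = refl

  four-vertices : ∀ {a b c d} → Unique (a ∷ b ∷ c ∷ d ∷ []) →
    TwoOrFour (tripleSum (edge a b c) (edge a b d) (edge a c d) (edge b c d))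
  four-vertices {a} {b} {c} {d} abcd! =
    tripleSum-twoOrFour (edge a b c) (edge a b d) (edge a c d) (edge b c d)
      (excluded (here refl)) (excluded (there (here refl))) (excluded (there (there (here refl))))
    where
    size : ∣ fromList (a ∷ b ∷ c ∷ d ∷ []) ∣ ≡ 4
    size = ∣fromList∣ abcd!

    count : inducedEdges H (fromList (a ∷ b ∷ c ∷ d ∷ [])) ≡
            tripleSum (edge a b c) (edge a b d) (edge a c d) (edge b c d)
    count = trans (count⊆-fromList isEdge abcd!)
      (subseqCount-triples (isEdge ∘ fromList) a b c d
        (λ w short → nonedge _ λ eq → contradiction (≤-trans (∣fromList∣≤ w) short)
                                        (<⇒≱ (≤-reflexive (sym eq))))
        (nonedge _ λ eq → contradiction (trans (sym size) eq) λ ()))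

    excluded : ∀ {f} → Forbidden (4 , f) →
      tripleSum (edge a b c) (edge a b d) (edge a c d) (edge b c d) ≢ f
    excluded q eq = free _ q _ (size , trans count eq)

  no-four-nonedges : ∀ {a b c d} → Unique (a ∷ b ∷ c ∷ d ∷ []) →
    edge a b c ≡ false → edge a b d ≡ false → edge a c d ≡ false → edge b c d ≡ false → ⊥
  no-four-nonedges abcd! p q r s with four-vertices abcd!
  ... | two-or-four rewrite p | q | r | s with two-or-four
  ... | inj₁ ()
  ... | inj₂ ()

  -- The vertex `zero` is the isolated vertex o. The diagonal is cut out because `edge zero x x` is
  -- false, its set having fewer than three elements, and would make x adjacent to itself.
  adj : Fin (suc m) → Fin (suc m) → Bool
  adj zero    _       = false
  adj (suc _) zero    = false
  adj (suc i) (suc j) = not (does (i ≟ᶠ j)) ∧ not (edge zero (suc i) (suc j))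

  adj-irrefl : ∀ x → adj x x ≡ false
  adj-irrefl zero = refl
  adj-irrefl (suc i) with i ≟ᶠ i
  ... | yes _  = refl
  ... | no i≢i = contradiction refl i≢i

  adj-distinct : ∀ {i j} → i ≢ j → adj (suc i) (suc j) ≡ not (edge zero (suc i) (suc j))
  adj-distinct {i} {j} i≢j with i ≟ᶠ j
  ... | yes i≡j = contradiction i≡j i≢j
  ... | no _    = refl

  adj-sym : ∀ x y → adj x y ≡ adj y x
  adj-sym zero zero = refl
  adj-sym zero (suc _) = refl
  adj-sym (suc _) zero = refl
  adj-sym (suc i) (suc j) with i ≟ᶠ j | j ≟ᶠ i
  ... | yes _   | yes _   = refl
  ... | no _    | no _    = cong not (edge-swapʳ zero (suc i) (suc j))
  ... | yes i≡j | no j≢i  = contradiction (sym i≡j) j≢i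
  ... | no i≢j  | yes j≡i = contradiction (sym j≡i) i≢j

  -- For a triple through `zero` this unfolds `adj`. Otherwise `zero`, x, y, z span an even number
  -- of edges, so the three triples through `zero` determine xyz.
  edge-adj : ∀ x y z → x ≢ y → x ≢ z → y ≢ z → edge x y z ≡ not (odd (adj x y) (adj y z) (adj x z))
  edge-adj zero zero _ x≢y _ _ = contradiction refl x≢y
  edge-adj zero (suc _) zero _ x≢z _ = contradiction refl x≢z
  edge-adj (suc _) zero zero _ _ y≢z = contradiction refl y≢z
  edge-adj zero (suc j) (suc k) _ _ y≢z
    rewrite adj-distinct (y≢z ∘ cong suc) = ≡-not-not-xor-false (edge zero (suc j) (suc k))
  edge-adj (suc i) zero (suc k) _ x≢z _
    rewrite adj-distinct (x≢z ∘ cong suc) =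
    trans (edge-swapˡ (suc i) zero (suc k)) (sym (Bool.not-involutive _))
  edge-adj (suc i) (suc j) zero x≢y _ _
    rewrite adj-distinct (x≢y ∘ cong suc) =
    trans (trans (edge-swapʳ (suc i) (suc j) zero) (edge-swapˡ (suc i) zero (suc j)))
      (≡-not-not-xor-false (edge zero (suc i) (suc j)))
  edge-adj x@(suc i) y@(suc j) z@(suc k) x≢y x≢z y≢z
    rewrite adj-distinct (x≢y ∘ cong suc) | adj-distinct (x≢z ∘ cong suc)
          | adj-distinct (y≢z ∘ cong suc) =
    even⇒fourth (edge zero x y) (edge zero x z) (edge zero y z) (edge x y z)
      (four-vertices {zero} {x} {y} {z}
        (((λ ()) ∷ (λ ()) ∷ (λ ()) ∷ []) ∷ (x≢y ∷ x≢z ∷ []) ∷ (y≢z ∷ []) ∷ [] ∷ []))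

  adj⇒≢ : ∀ x y → adj x y ≡ true → x ≢ y
  adj⇒≢ x _ x∼y refl with trans (sym x∼y) (adj-irrefl x)
  ... | ()

  separated : ∀ x y z → adj x z ≡ true → adj y z ≡ false → x ≢ y
  separated _ _ _ x∼z y≁z refl with trans (sym x∼z) y≁z
  ... | ()

  -- Together with `zero` a triangle would span no edge of `H`: the triples through `zero` are
  -- non-edges by the choice of `adj`, and xyz contains three edges of the graph, an odd number.
  triangle-free : ∀ x y z → adj x y ≡ true → adj y z ≡ true → adj x z ≡ true → ⊥
  triangle-free zero _ _ () _ _
  triangle-free (suc _) zero _ () _ _
  triangle-free (suc _) (suc _) zero _ () _
  triangle-free x@(suc i) y@(suc j) z@(suc k) x∼y y∼z x∼z =
    no-four-nonedges {zero} {x} {y} {z}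
      (((λ ()) ∷ (λ ()) ∷ (λ ()) ∷ []) ∷ (x≢y ∷ x≢z ∷ []) ∷ (y≢z ∷ []) ∷ [] ∷ [])
      (at-zero x≢y x∼y) (at-zero x≢z x∼z) (at-zero y≢z y∼z)
      (trans (edge-adj x y z x≢y x≢z y≢z) (cong not (cong₂ _xor_ x∼y (cong₂ _xor_ y∼z x∼z))))
    where
    x≢y = adj⇒≢ x y x∼y
    x≢z = adj⇒≢ x z x∼z
    y≢z = adj⇒≢ y z y∼z
    at-zero : ∀ {i j} → suc i ≢ suc j → adj (suc i) (suc j) ≡ true → edge zero (suc i) (suc j) ≡ false
    at-zero i≢j i∼j = Bool.not-injective (trans (sym (adj-distinct (i≢j ∘ cong suc))) i∼j)

  -- Each of the four triples contains exactly one edge of the graph, so none is an edge of `H`.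
  2K₂-free : ∀ a b c d → adj a b ≡ true → adj c d ≡ true →
    adj a c ≡ false → adj a d ≡ false → adj b c ≡ false → adj b d ≡ false → ⊥
  2K₂-free a b c d a∼b c∼d a≁c a≁d b≁c b≁d =
    no-four-nonedges {a} {b} {c} {d}
      ((a≢b ∷ a≢c ∷ a≢d ∷ []) ∷ (b≢c ∷ b≢d ∷ []) ∷ (c≢d ∷ []) ∷ [] ∷ [])
      (nonedge′ a b c refl a≢b a≢c b≢c a∼b b≁c a≁c)
      (nonedge′ a b d refl a≢b a≢d b≢d a∼b b≁d a≁d)
      (nonedge′ a c d refl a≢c a≢d c≢d a≁c c∼d a≁d)
      (nonedge′ b c d refl b≢c b≢d c≢d b≁c c∼d b≁d)
    where
    d∼c = trans (adj-sym d c) c∼d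
    a≢b = adj⇒≢ a b a∼b
    c≢d = adj⇒≢ c d c∼d
    a≢c = ≢-sym (separated c a d c∼d a≁d)
    a≢d = ≢-sym (separated d a c d∼c a≁c)
    b≢c = ≢-sym (separated c b d c∼d b≁d)
    b≢d = ≢-sym (separated d b c d∼c b≁c)
    nonedge′ : ∀ x y z {p q r} → odd p q r ≡ true → x ≢ y → x ≢ z → y ≢ z →
      adj x y ≡ p → adj y z ≡ q → adj x z ≡ r → edge x y z ≡ false
    nonedge′ x y z odd≡ x≢y x≢z y≢z p q r =
      trans (edge-adj x y z x≢y x≢z y≢z)
        (cong not (trans (cong₂ _xor_ p (cong₂ _xor_ q r)) odd≡))

  -- The hypothesis also covers repeated vertices, so no distinctness has to be tracked when
  -- vertices are replaced by their classes, which may coincide.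
  even⇒clique : (S : Subset (suc m)) →
    (∀ {x y z} → x ∈ˢ S → y ∈ˢ S → z ∈ˢ S → odd (adj x y) (adj y z) (adj x z) ≡ false) →
    Clique H S
  even⇒clique S even e ∣e∣ e⊆S with elements-of-size 3 e ∣e∣
  ... | x ∷ y ∷ z ∷ [] , (x≢y ∷ x≢z ∷ []) ∷ (y≢z ∷ []) ∷ [] ∷ [] , refl , refl =
    subst T (sym (trans (edge-adj x y z x≢y x≢z y≢z) (cong not (even
      (at (here refl)) (at (there (here refl))) (at (there (there (here refl)))))))) _
    where
    at : ∀ {v} → v ∈ (x ∷ y ∷ z ∷ []) → v ∈ˢ S
    at v∈ = e⊆S (∈-fromList v∈)

-- The lower bound

∣b∷p∣ : ∀ b (p : Subset n) → ∣ b ∷ p ∣ ≡ b2n b + ∣ p ∣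
∣b∷p∣ true  p = refl
∣b∷p∣ false p = refl

preimage : (Fin n → Fin k) → Subset k → Subset n
preimage κ U = tabulate λ x → lookup U (κ x)

∈-tabulate⁻ : ∀ (f : Fin n → Bool) {x} → x ∈ˢ tabulate f → f x ≡ true
∈-tabulate⁻ f {x} x∈ = trans (sym (lookup∘tabulate f x)) ([]=⇒lookup x∈)

classSizes : (Fin n → Fin k) → Vec ℕ k
classSizes {zero}  κ = replicate _ 0
classSizes {suc n} κ = updateAt (classSizes (κ ∘ suc)) (κ zero) suc

-- For a concrete `U` this reduces to the sum of the selected entries followed by `+ 0`, the shape
-- seen in `total` and `conclude`.
weight : Subset k → Vec ℕ k → ℕ
weight []      []       = 0
weight (u ∷ U) (a ∷ as) = (if u then a else 0) + weight U as

weight-0 : (U : Subset k) → weight U (replicate k 0) ≡ 0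
weight-0 []          = refl
weight-0 (true ∷ U)  = weight-0 U
weight-0 (false ∷ U) = weight-0 U

weight-suc : (U : Subset k) (as : Vec ℕ k) (i : Fin k) →
  weight U (updateAt as i suc) ≡ b2n (lookup U i) + weight U as
weight-suc (true ∷ U)  (a ∷ as) zero = refl
weight-suc (false ∷ U) (a ∷ as) zero = refl
weight-suc (u ∷ U) (a ∷ as) (suc i) =
  trans (cong ((if u then a else 0) +_) (weight-suc U as i))
    (x+[y+z]≡y+[x+z] (if u then a else 0) (b2n (lookup U i)) (weight U as))
  where
  x+[y+z]≡y+[x+z] : ∀ x y z → x + (y + z) ≡ y + (x + z)
  x+[y+z]≡y+[x+z] = solve-∀

sum-0 : ∀ k → sum (replicate k 0) ≡ 0
sum-0 zero    = refl
sum-0 (suc k) = sum-0 k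

sum-suc : (as : Vec ℕ k) (i : Fin k) → sum (updateAt as i suc) ≡ suc (sum as)
sum-suc (a ∷ as) zero = refl
sum-suc (a ∷ as) (suc i) = trans (cong (a +_) (sum-suc as i)) (+-suc a (sum as))

sum-classSizes : (κ : Fin n → Fin k) → sum (classSizes κ) ≡ n
sum-classSizes {zero} {k} κ = sum-0 k
sum-classSizes {suc n} κ =
  trans (sum-suc (classSizes (κ ∘ suc)) (κ zero)) (cong suc (sum-classSizes (κ ∘ suc)))

∣preimage∣ : (κ : Fin n → Fin k) (U : Subset k) → ∣ preimage κ U ∣ ≡ weight U (classSizes κ)
∣preimage∣ {zero} κ U  = sym (weight-0 U)
∣preimage∣ {suc n} κ U = begin
  ∣ preimage κ U ∣
    ≡⟨ ∣b∷p∣ (lookup U (κ zero)) (preimage (κ ∘ suc) U) ⟩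
  b2n (lookup U (κ zero)) + ∣ preimage (κ ∘ suc) U ∣
    ≡⟨ cong (b2n (lookup U (κ zero)) +_) (∣preimage∣ (κ ∘ suc) U) ⟩
  b2n (lookup U (κ zero)) + weight U (classSizes (κ ∘ suc))
    ≡⟨ weight-suc U (classSizes (κ ∘ suc)) (κ zero) ⟨
  weight U (classSizes κ) ∎
  where open ≡-Reasoning

-- First the independent triples of C₅ + K₁, then the paths of the pentagon.
evenTriples : List (Subset 6)
evenTriples =
  (true  ∷ false ∷ true  ∷ false ∷ false ∷ true  ∷ []) ∷
  (true  ∷ false ∷ false ∷ true  ∷ false ∷ true  ∷ []) ∷
  (false ∷ true  ∷ false ∷ true  ∷ false ∷ true  ∷ []) ∷
  (false ∷ true  ∷ false ∷ false ∷ true  ∷ true  ∷ []) ∷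
  (false ∷ false ∷ true  ∷ false ∷ true  ∷ true  ∷ []) ∷
  (true  ∷ true  ∷ false ∷ false ∷ true  ∷ false ∷ []) ∷
  (true  ∷ true  ∷ true  ∷ false ∷ false ∷ false ∷ []) ∷
  (false ∷ true  ∷ true  ∷ true  ∷ false ∷ false ∷ []) ∷
  (false ∷ false ∷ true  ∷ true  ∷ true  ∷ false ∷ []) ∷
  (true  ∷ false ∷ false ∷ true  ∷ true  ∷ false ∷ []) ∷ []

Even : Fin 6 → Fin 6 → Fin 6 → Set
Even i j k = odd (M i j) (M j k) (M i k) ≡ false

even? : ∀ i j k → Dec (Even i j k)
even? i j k = odd (M i j) (M j k) (M i k) Bool.≟ false

EvenOn : Subset 6 → Set
EvenOn U = ∀ i j k → lookup U i ≡ true → lookup U j ≡ true → lookup U k ≡ true → Even i j k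

evenOn? : ∀ U → Dec (EvenOn U)
evenOn? U = all? λ i → all? λ j → all? λ k →
  (lookup U i Bool.≟ true) →-dec (lookup U j Bool.≟ true) →-dec (lookup U k Bool.≟ true) →-dec
  even? i j k

abstract
  evenTriples-even : All EvenOn evenTriples
  evenTriples-even = from-true (All.all? evenOn? evenTriples)

all-extremal : ∀ {n} (xs : List ℕ) → All (_≤ n) xs → sumˡ xs ≡ length xs * n → All (_≡ n) xs
all-extremal [] [] _ = []
all-extremal {n} (x ∷ xs) (x≤n ∷ xs≤n) eq = x≡n ∷ all-extremal xs xs≤n
    (+-cancelˡ-≡ x _ _ (trans eq (cong (_+ length xs * n) (sym x≡n))))
  where
  sum≤ : ∀ {xs} → All (_≤ n) xs → sumˡ xs ≤ length xs * n
  sum≤ [] = z≤n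
  sum≤ (y≤n ∷ ys≤n) = +-mono-≤ y≤n (sum≤ ys≤n)
  x≡n : x ≡ n
  x≡n = ≤-antisym x≤n (+-cancelʳ-≤ (length xs * n) n x
          (≤-trans (≤-reflexive (sym eq)) (+-monoʳ-≤ x (sum≤ xs≤n))))

halve : ∀ {x y n} → 2 * x ≡ n → 2 * y ≡ n → x ≡ y
halve {x} {y} 2x≡n 2y≡n = *-cancelˡ-≡ x y 2 (trans 2x≡n (sym 2y≡n))

-- By `total` the ten inequalities add up to an equality, so all are tight; two tight triples that
-- differ in one class force equal class sizes.
all-triples-small : (as : Vec ℕ 6) → All (λ U → 2 * weight U as ≤ sum as) evenTriples →
  ∃[ a ] (sum as ≡ a * 6) × All (λ U → 2 * weight U as ≡ sum as) evenTriples
all-triples-small as@(a₀ ∷ a₁ ∷ a₂ ∷ a₃ ∷ a₄ ∷ a₅ ∷ []) small =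
  a₅ , classes-equal tight , tight
  where
  total : ∀ a₀ a₁ a₂ a₃ a₄ a₅ →
    2 * (a₀ + (a₂ + (a₅ + 0))) + (2 * (a₀ + (a₃ + (a₅ + 0))) + (2 * (a₁ + (a₃ + (a₅ + 0))) +
    (2 * (a₁ + (a₄ + (a₅ + 0))) + (2 * (a₂ + (a₄ + (a₅ + 0))) + (2 * (a₀ + (a₁ + (a₄ + 0))) +
    (2 * (a₀ + (a₁ + (a₂ + 0))) + (2 * (a₁ + (a₂ + (a₃ + 0))) + (2 * (a₂ + (a₃ + (a₄ + 0))) +
    (2 * (a₀ + (a₃ + (a₄ + 0))) + 0)))))))))
    ≡ 10 * (a₀ + (a₁ + (a₂ + (a₃ + (a₄ + (a₅ + 0))))))
  total = solve-∀

  tight : All (λ U → 2 * weight U as ≡ sum as) evenTriples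
  tight = All.map⁻ (all-extremal (map (λ U → 2 * weight U as) evenTriples) (All.map⁺ small)
            (total a₀ a₁ a₂ a₃ a₄ a₅))

  sextuple : ∀ a → a + (a + (a + (a + (a + (a + 0))))) ≡ a * 6
  sextuple = solve-∀

  conclude : a₁ ≡ a₀ → a₂ ≡ a₁ → a₂ ≡ a₃ → a₄ ≡ a₃ → a₀ + (a₁ + (a₄ + 0)) ≡ a₀ + (a₂ + (a₅ + 0)) →
    sum as ≡ a₅ * 6
  conclude refl refl refl refl eq
    with refl ← +-cancelʳ-≡ 0 a₀ a₅ (+-cancelˡ-≡ a₀ (a₀ + 0) (a₅ + 0)
                  (+-cancelˡ-≡ a₀ (a₀ + (a₀ + 0)) (a₀ + (a₅ + 0)) eq)) = sextuple a₅

  classes-equal : All (λ U → 2 * weight U as ≡ sum as) evenTriples → sum as ≡ a₅ * 6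
  -- The five independent triples all contain `v5`, so they compare only pentagon classes with one
  -- another; the path 4, 0, 1 brings in `a₅`.
  classes-equal (e₀₂₅ ∷ e₀₃₅ ∷ e₁₃₅ ∷ e₁₄₅ ∷ e₂₄₅ ∷ e₀₁₄ ∷ _) =
    conclude
      (+-cancelʳ-≡ (a₃ + (a₅ + 0)) a₁ a₀ (halve e₁₃₅ e₀₃₅))
      (+-cancelʳ-≡ (a₄ + (a₅ + 0)) a₂ a₁ (halve e₂₄₅ e₁₄₅))
      (+-cancelʳ-≡ (a₅ + 0) a₂ a₃ (+-cancelˡ-≡ a₀ (a₂ + (a₅ + 0)) (a₃ + (a₅ + 0)) (halve e₀₂₅ e₀₃₅)))
      (+-cancelʳ-≡ (a₅ + 0) a₄ a₃ (+-cancelˡ-≡ a₁ (a₄ + (a₅ + 0)) (a₃ + (a₅ + 0)) (halve e₁₄₅ e₁₃₅)))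
      (halve e₀₁₄ e₀₂₅)

-- The second alternative is there for the balanced blow-up, where `s` may be exactly half of `n`.
-- Doubling `s` avoids rounding.
Heavy : ℕ → ℕ → Set
Heavy n s = n < 2 * s ⊎ (n % 6 ≡ 0 × n ≤ 2 * s)

heavy-triple : (as : Vec ℕ 6) → ∃[ U ] U ∈ evenTriples × Heavy (sum as) (weight U as)
heavy-triple as with Any.any? (λ U → sum as <? 2 * weight U as) evenTriples
... | yes any = let U , U∈ , heavy = find any in U , U∈ , inj₁ heavy
... | no none with all-triples-small as (All.map ≮⇒≥ (All.¬Any⇒All¬ evenTriples none))
-- All ten triples have exactly half the total weight, so the first one serves.
... | a , sum≡a*6 , exact ∷ _ =
  _ , here refl , inj₂ (trans (cong (_% 6) sum≡a*6) (m*n%n≡0 a 6) , ≤-reflexive (sym exact))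

heavy-preimage : (κ : Fin n → Fin 6) → ∃[ U ] U ∈ evenTriples × Heavy n ∣ preimage κ U ∣
heavy-preimage κ with heavy-triple (classSizes κ)
... | U , U∈ , heavy =
  U , U∈ , subst₂ Heavy (sum-classSizes κ) (sym (∣preimage∣ κ U)) heavy

∣tabulate∣+∣tabulate-not∣ : (f : Fin n → Bool) → ∣ tabulate f ∣ + ∣ tabulate (not ∘ f) ∣ ≡ n
∣tabulate∣+∣tabulate-not∣ {zero} f = refl
∣tabulate∣+∣tabulate-not∣ {suc n} f with f zero
... | true  = cong suc (∣tabulate∣+∣tabulate-not∣ (f ∘ suc))
... | false = trans (+-suc _ _) (cong suc (∣tabulate∣+∣tabulate-not∣ (f ∘ suc)))

-- Here `m` counts the vertices other than o, and `x` the larger colour class among them; adding o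
-- to both makes the inequality strict.
m≤x+x⇒1+m<2[1+x] : ∀ {m x} → m ≤ x + x → suc m < 2 * suc x
m≤x+x⇒1+m<2[1+x] {m} {x} m≤x+x = subst (suc m <_) (double x) (s≤s (s≤s m≤x+x))
  where
  double : ∀ x → 2 + (x + x) ≡ 2 * suc x
  double = solve-∀

LargeClique : ∀ {n} → RGraph 3 n → Set
LargeClique {n} H = ∃[ S ] Clique H S × Heavy n ∣ S ∣

large-clique : ∀ {m} (H : RGraph 3 (suc m)) → QFree H Forbidden → LargeClique H
large-clique {m} H free = result
  where
  open TwoGraph H free
  open Graph adj adj-sym triangle-free 2K₂-free zero (λ _ → refl)

  module Bipartite (A : Fin (suc m) → Bool) (proper : Proper A) where

    -- Stated for any `B` inside one colour class, so that it serves both colours; `zero` joins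
    -- either one because it is isolated.
    independent : ∀ (B : Fin m → Bool) →
      (∀ i j → B i ≡ true → B j ≡ true → A (suc i) ≡ A (suc j)) →
      ∀ x y → x ∈ˢ (inside ∷ tabulate B) → y ∈ˢ (inside ∷ tabulate B) → adj x y ≡ false
    independent B B⇒A zero _ _ _ = refl
    independent B B⇒A (suc i) zero _ _ = refl
    independent B B⇒A (suc i) (suc j) (Vec.there i∈) (Vec.there j∈) = Bool.¬-not λ i∼j →
      proper (suc i) (suc j) i∼j (B⇒A i j (∈-tabulate⁻ B i∈) (∈-tabulate⁻ B j∈))

    clique : ∀ B → (∀ i j → B i ≡ true → B j ≡ true → A (suc i) ≡ A (suc j)) →
      Clique H (inside ∷ tabulate B)
    clique B B⇒A = even⇒clique _ λ x∈ y∈ z∈ →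
      cong₂ _xor_ (ind x∈ y∈) (cong₂ _xor_ (ind y∈ z∈) (ind x∈ z∈))
      where
      ind : ∀ {x y} → x ∈ˢ (inside ∷ tabulate B) → y ∈ˢ (inside ∷ tabulate B) → adj x y ≡ false
      ind = independent B B⇒A _ _

    p q : ℕ
    p = ∣ tabulate (A ∘ suc) ∣
    q = ∣ tabulate (not ∘ A ∘ suc) ∣

    p+q≡m : p + q ≡ m
    p+q≡m = ∣tabulate∣+∣tabulate-not∣ (A ∘ suc)

    large : LargeClique H
    large with ≤-total p q
    ... | inj₁ p≤q = _ , clique (not ∘ A ∘ suc) (λ i j i∈ j∈ →
            Bool.not-injective (trans i∈ (sym j∈))) ,
            inj₁ (m≤x+x⇒1+m<2[1+x] (subst (_≤ q + q) p+q≡m (+-monoˡ-≤ q p≤q)))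
    ... | inj₂ q≤p = _ , clique (A ∘ suc) (λ i j i∈ j∈ → trans i∈ (sym j∈)) ,
            inj₁ (m≤x+x⇒1+m<2[1+x] (subst (_≤ p + p) p+q≡m (+-monoʳ-≤ p q≤p)))

  module Nonbipartite (c₀ c₁ c₂ c₃ c₄ : Fin (suc m)) (pent : IsPentagon c₀ c₁ c₂ c₃ c₄) where
    open Pentagon c₀ c₁ c₂ c₃ c₄ pent

    clique : ∀ U → EvenOn U → Clique H (preimage class U)
    clique U even = even⇒clique _ λ {x} {y} {z} x∈ y∈ z∈ →
      trans (cong₂ _xor_ (adj-class x y) (cong₂ _xor_ (adj-class y z) (adj-class x z)))
        (even _ _ _ (member x∈) (member y∈) (member z∈))
      where
      member : ∀ {x} → x ∈ˢ preimage class U → lookup U (class x) ≡ true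
      member = ∈-tabulate⁻ (lookup U ∘ class)

    large : LargeClique H
    large = let U , U∈ , heavy = heavy-preimage class in
      preimage class U , clique U (All.lookup evenTriples-even U∈) , heavy

  result : LargeClique H
  result with bipartite-or-pentagon
  ... | inj₁ (A , proper) = Bipartite.large A proper
  ... | inj₂ (c₀ , c₁ , c₂ , c₃ , c₄ , pent) = Nonbipartite.large c₀ c₁ c₂ c₃ c₄ pent

-- The extremal hypergraphs

onTriples : (List C → Bool) → List C → Bool
onTriples g w = (length w ≡ᵇ 3) ∧ g w

onTriples⁻ : (g : List C → Bool) (w : List C) → T (onTriples g w) → length w ≡ 3 × T (g w)
onTriples⁻ g w p = let len , gw = Equivalence.to Bool.T-∧ p in ≡ᵇ⇒≡ (length w) 3 len , gw

wordGraph : (Fin n → C) → (List C → Bool) → RGraph 3 n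
wordGraph κ g = record
  { isEdge  = onTriples g ∘ word κ
  ; uniform = λ e e-edge →
      trans (sym (length-word κ e)) (proj₁ (onTriples⁻ g (word κ e) e-edge))
  }

FourWords : (List C → Bool) → Set
FourWords g = ∀ a b c d → TwoOrFour (subseqCount (onTriples g) (a ∷ b ∷ c ∷ d ∷ []))

-- The number of edges inside a set depends only on its word of colours, so checking words of length
-- four covers every `n` and every colouring.
wordGraph-free : (κ : Fin n → C) (g : List C → Bool) → FourWords g → QFree (wordGraph κ g) Forbidden
wordGraph-free κ g four (m , j) q S (∣S∣≡m , count≡j) =
  excluded q (word κ S) (trans (length-word κ S) ∣S∣≡m)
    (trans (sym (count⊆-word κ (onTriples g) S)) count≡j)
  where
  two-or-four : ∀ w → length w ≡ 4 → TwoOrFour (subseqCount (onTriples g) w)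
  two-or-four (a ∷ b ∷ c ∷ d ∷ []) refl = four a b c d

  excluded : ∀ {m j} → Forbidden (m , j) → ∀ w → length w ≡ m → subseqCount (onTriples g) w ≢ j
  excluded (here refl) w len eq with two-or-four w len
  ... | inj₁ two  = contradiction (trans (sym eq) two) λ ()
  ... | inj₂ four = contradiction (trans (sym eq) four) λ ()
  excluded (there (here refl)) w len eq with two-or-four w len
  ... | inj₁ two  = contradiction (trans (sym eq) two) λ ()
  ... | inj₂ four = contradiction (trans (sym eq) four) λ ()
  excluded (there (there (here refl))) w len eq with two-or-four w len
  ... | inj₁ two  = contradiction (trans (sym eq) two) λ ()
  ... | inj₂ four = contradiction (trans (sym eq) four) λ ()

TriplesIn : (Fin n → C) → (List C → Bool) → Subset n → Set
TriplesIn κ g S = ∀ e → ∣ e ∣ ≡ 3 → e ⊆ S → T (g (word κ e))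

clique⇒TriplesIn : (κ : Fin n → C) (g : List C → Bool) {S : Subset n} →
  Clique (wordGraph κ g) S → TriplesIn κ g S
clique⇒TriplesIn κ g clique e ∣e∣ e⊆S =
  proj₂ (onTriples⁻ g (word κ e) (clique e ∣e∣ e⊆S))

-- The hypergraph of alternating signs

sign : Fin n → Bool
sign zero          = true
sign (suc zero)    = false
sign (suc (suc i)) = sign i

nonalternating : List Bool → Bool
nonalternating (a ∷ b ∷ c ∷ _) = not ((a xor b) ∧ (b xor c))
nonalternating _               = true

signGraph : ∀ n → RGraph 3 n
signGraph n = wordGraph sign nonalternating

abstract
  signGraph-four : FourWords nonalternating
  signGraph-four a b c d = from-true (allSubsets? λ (S : Subset 4) →
    twoOrFour? (subseqCount (onTriples nonalternating) (toList S))) (a ∷ b ∷ c ∷ d ∷ [])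

word-∅ : (κ : Fin n → C) → word κ ∅ ≡ []
word-∅ {zero} κ  = refl
word-∅ {suc n} κ = word-∅ (κ ∘ suc)

word-⁅x⁆ : (κ : Fin n → C) (x : Fin n) → word κ ⁅ x ⁆ ≡ κ x ∷ []
word-⁅x⁆ κ zero    = cong (κ zero ∷_) (word-∅ (κ ∘ suc))
word-⁅x⁆ κ (suc x) = word-⁅x⁆ (κ ∘ suc) x

-- Vertices come in consecutive pairs, the positive one first: `S` meets each pair at most in its
-- second vertex and misses an unpaired last vertex.
negatives-bound : (S : Subset n) → (∀ {x} → x ∈ˢ S → sign x ≡ false) → ∣ S ∣ ≤ ⌊ n /2⌋
negatives-bound [] neg = z≤n
negatives-bound (inside ∷ S) neg = contradiction (neg Vec.here) λ ()
negatives-bound (outside ∷ []) neg = z≤n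
negatives-bound (outside ∷ inside ∷ S) neg =
  s≤s (negatives-bound S λ x∈ → neg (Vec.there (Vec.there x∈)))
negatives-bound (outside ∷ outside ∷ S) neg =
  m≤n⇒m≤1+n (negatives-bound S λ x∈ → neg (Vec.there (Vec.there x∈)))

signTriples-drop : ∀ {a b} {S : Subset n} → TriplesIn sign nonalternating (a ∷ b ∷ S) →
  TriplesIn sign nonalternating S
signTriples-drop triples e ∣e∣ e⊆S = triples (outside ∷ outside ∷ e) ∣e∣ (out⊆ (out⊆ e⊆S))

-- If S contains both of its first two vertices, no later vertex of S is positive.
signClique-bound : (S : Subset n) → TriplesIn sign nonalternating S → ∣ S ∣ ≤ suc ⌊ n /2⌋
signClique-bound [] _ = z≤n
signClique-bound (b ∷ []) _ = ∣p∣≤n (b ∷ [])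
signClique-bound (outside ∷ outside ∷ S) triples =
  m≤n⇒m≤1+n (signClique-bound S (signTriples-drop triples))
signClique-bound (outside ∷ inside ∷ S) triples =
  s≤s (signClique-bound S (signTriples-drop triples))
signClique-bound (inside ∷ outside ∷ S) triples =
  s≤s (signClique-bound S (signTriples-drop triples))
-- Here the extra one in the bound is spent: both vertices of this pair are taken, and at most one
-- of each later pair.
signClique-bound (inside ∷ inside ∷ S) triples = s≤s (s≤s (negatives-bound S negative))
  where
  negative : ∀ {x} → x ∈ˢ S → sign x ≡ false
  negative {x} x∈S with sign x in sx
  ... | false = refl
  -- With the first two vertices a positive `x` would form the alternating triple +, -, +.
  ... | true  = ⊥-elim (subst (λ w → T (nonalternating (true ∷ false ∷ w)))
                  (trans (word-⁅x⁆ sign x) (cong (_∷ []) sx))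
                  (triples (inside ∷ inside ∷ ⁅ x ⁆) (cong (2 +_) (∣⁅x⁆∣≡1 x))
                    (in⊆in (in⊆in λ y∈ → subst (_∈ˢ S) (sym (x∈⁅y⁆⇒x≡y x y∈)) x∈S))))

-- The balanced blow-up of C₅ + K₁

AllEven : List (Fin 6) → Set
AllEven w = All (λ i → All (λ j → All (Even i j) w) w) w

allEven? : ∀ w → Dec (AllEven w)
allEven? w = All.all? (λ i → All.all? (λ j → All.all? (even? i j) w) w) w

-- All ordered triples of letters are tested, repeats included. On three letters this agrees with
-- testing them once, since parity is symmetric and repeats are even, but it lets
-- `blowupClique-even` take its vertices in any order.
evenWord : List (Fin 6) → Bool
evenWord w = isYes (allEven? w)

mod6 : Fin n → Fin 6
mod6 v0 = v0
mod6 v1 = v1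
mod6 v2 = v2
mod6 v3 = v3
mod6 v4 = v4
mod6 v5 = v5
mod6 (suc (suc (suc (suc (suc (suc i)))))) = mod6 i

blowup : ∀ n → RGraph 3 n
blowup n = wordGraph mod6 evenWord

abstract
  blowup-four : FourWords evenWord
  blowup-four = from-true (all? λ a → all? λ b → all? λ c → all? λ d →
    twoOrFour? (subseqCount (onTriples evenWord) (a ∷ b ∷ c ∷ d ∷ [])))

  evenOn⇒≤3 : ∀ U → EvenOn U → ∣ U ∣ ≤ 3
  evenOn⇒≤3 = from-true (allSubsets? λ U → evenOn? U →-dec (∣ U ∣ ≤? 3))

  even-repeat : ∀ i j → Even i i j × Even i j i × Even j i i
  even-repeat = from-true (all? λ i → all? λ j → even? i i j ×-dec even? i j i ×-dec even? j i i)

∈-word : (κ : Fin n → C) {S : Subset n} {x : Fin n} → x ∈ˢ S → κ x ∈ word κ S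
∈-word κ {inside ∷ S} Vec.here = here refl
∈-word κ {inside ∷ S} (Vec.there x∈) = there (∈-word (κ ∘ suc) x∈)
∈-word κ {outside ∷ S} (Vec.there x∈) = ∈-word (κ ∘ suc) x∈

fromList⊆ : {S : Subset n} (xs : List (Fin n)) → All (_∈ˢ S) xs → fromList xs ⊆ S
fromList⊆ [] _ x∈ = contradiction x∈ ∉⊥
fromList⊆ {S = S} (y ∷ ys) (y∈ ∷ ys∈) x∈ with x∈p∪q⁻ ⁅ y ⁆ (fromList ys) x∈
... | inj₁ x∈y  = subst (_∈ˢ S) (sym (x∈⁅y⁆⇒x≡y y x∈y)) y∈
... | inj₂ x∈ys = fromList⊆ ys ys∈ x∈ys

blowupClique-even : {S : Subset n} → TriplesIn mod6 evenWord S →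
  ∀ {x y z} → x ∈ˢ S → y ∈ˢ S → z ∈ˢ S → Even (mod6 x) (mod6 y) (mod6 z)
blowupClique-even triples {x} {y} {z} x∈ y∈ z∈ with x ≟ᶠ y | x ≟ᶠ z | y ≟ᶠ z
... | yes refl | _ | _ = proj₁ (even-repeat (mod6 x) (mod6 z))
... | no _ | yes refl | _ = proj₁ (proj₂ (even-repeat (mod6 x) (mod6 y)))
... | no _ | no _ | yes refl = proj₂ (proj₂ (even-repeat (mod6 y) (mod6 x)))
... | no x≢y | no x≢z | no y≢z =
  All.lookup (All.lookup (All.lookup all-even (at (here refl))) (at (there (here refl))))
    (at (there (there (here refl))))
  where
  e = fromList (x ∷ y ∷ z ∷ [])
  all-even : AllEven (word mod6 e)
  all-even = toWitness {a? = allEven? (word mod6 e)} (triples e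
    (∣fromList∣ ((x≢y ∷ x≢z ∷ []) ∷ (y≢z ∷ []) ∷ [] ∷ []))
    (fromList⊆ (x ∷ y ∷ z ∷ []) (x∈ ∷ y∈ ∷ z∈ ∷ [])))
  at : ∀ {v} → v ∈ (x ∷ y ∷ z ∷ []) → mod6 v ∈ word mod6 e
  at v∈ = ∈-word mod6 (∈-fromList v∈)

∣p++q∣ : ∀ {m} (p : Subset m) (q : Subset n) → ∣ p Vec.++ q ∣ ≡ ∣ p ∣ + ∣ q ∣
∣p++q∣ [] q = refl
∣p++q∣ (true ∷ p) q  = cong suc (∣p++q∣ p q)
∣p++q∣ (false ∷ p) q = ∣p++q∣ p q

-- A block of six consecutive vertices meets every class once, so `S` has at most `∣ U ∣` vertices
-- in each of the `k` blocks.
mod6-bound : ∀ k (S : Subset (k * 6)) (U : Subset 6) →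
  (∀ {x} → x ∈ˢ S → lookup U (mod6 x) ≡ true) → ∣ S ∣ ≤ k * ∣ U ∣
mod6-bound zero [] U _ = z≤n
mod6-bound (suc k) (s₀ ∷ s₁ ∷ s₂ ∷ s₃ ∷ s₄ ∷ s₅ ∷ S) U S⊆U =
  ≤-trans (≤-reflexive (∣p++q∣ block S))
    (+-mono-≤ (p⊆q⇒∣p∣≤∣q∣ (λ {x} x∈ → lookup⇒[]= x U (block⊆U x x∈)))
      (mod6-bound k S U λ x∈ → S⊆U
        (Vec.there (Vec.there (Vec.there (Vec.there (Vec.there (Vec.there x∈))))))))
  where
  block = s₀ ∷ s₁ ∷ s₂ ∷ s₃ ∷ s₄ ∷ s₅ ∷ []
  block⊆U : ∀ x → x ∈ˢ block → lookup U x ≡ true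
  block⊆U v0 Vec.here = S⊆U Vec.here
  block⊆U v1 (Vec.there Vec.here) = S⊆U (Vec.there Vec.here)
  block⊆U v2 (Vec.there (Vec.there Vec.here)) = S⊆U (Vec.there (Vec.there Vec.here))
  block⊆U v3 (Vec.there (Vec.there (Vec.there Vec.here))) =
    S⊆U (Vec.there (Vec.there (Vec.there Vec.here)))
  block⊆U v4 (Vec.there (Vec.there (Vec.there (Vec.there Vec.here)))) =
    S⊆U (Vec.there (Vec.there (Vec.there (Vec.there Vec.here))))
  block⊆U v5 (Vec.there (Vec.there (Vec.there (Vec.there (Vec.there Vec.here))))) =
    S⊆U (Vec.there (Vec.there (Vec.there (Vec.there (Vec.there Vec.here)))))

-- The classes met by a clique form an even set `U`, hence there are at most three of them, each
-- with `k` vertices.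
blowupClique-bound : ∀ k (S : Subset (k * 6)) → TriplesIn mod6 evenWord S → ∣ S ∣ ≤ k * 3
blowupClique-bound k S triples =
  ≤-trans (mod6-bound k S U ∈⇒used) (*-monoʳ-≤ k (evenOn⇒≤3 U U-even))
  where
  Used : Fin 6 → Set
  Used c = ∃[ x ] (x ∈ˢ S × mod6 x ≡ c)

  used? : ∀ c → Dec (Used c)
  used? c = any? λ x → (x ∈? S) ×-dec (mod6 x ≟ᶠ c)

  U : Subset 6
  U = tabulate (isYes ∘ used?)

  ∈⇒used : ∀ {x} → x ∈ˢ S → lookup U (mod6 x) ≡ true
  ∈⇒used {x} x∈ = trans (lookup∘tabulate (isYes ∘ used?) (mod6 x))
    (Equivalence.to Bool.T-≡ (fromWitness {a? = used? (mod6 x)} (x , x∈ , refl)))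

  used : ∀ c → lookup U c ≡ true → Used c
  used c eq = toWitness {a? = used? c} (Equivalence.from Bool.T-≡
    (trans (sym (lookup∘tabulate (isYes ∘ used?) c)) eq))

  U-even : EvenOn U
  U-even i j k i∈ j∈ k∈ with used i i∈ | used j j∈ | used k k∈
  ... | x , x∈ , refl | y , y∈ , refl | z , z∈ , refl = blowupClique-even triples x∈ y∈ z∈

-- From cliques to h

shrink : ∀ k (S : Subset n) → k ≤ ∣ S ∣ → ∃[ e ] (e ⊆ S × ∣ e ∣ ≡ k)
shrink {n} zero S _ = ∅ , ⊥⊆ , ∣⊥∣≡0 n
shrink (suc k) (inside ∷ S) (s≤s k≤) with shrink k S k≤
... | e , e⊆S , ∣e∣ = inside ∷ e , in⊆in e⊆S , cong suc ∣e∣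
shrink (suc k) (outside ∷ S) k≤ with shrink (suc k) S k≤
... | e , e⊆S , ∣e∣ = outside ∷ e , out⊆ e⊆S , ∣e∣

-- Four of its vertices would induce a (4,0)-graph.
coclique≤3 : (H : RGraph 3 n) → QFree H Forbidden → ∀ S → Coclique H S → ∣ S ∣ ≤ 3
coclique≤3 {n} H free S coclique = ≮⇒≥ λ 3<∣S∣ →
  let e , e⊆S , ∣e∣ = shrink 4 S 3<∣S∣ in
  free (4 , 0) (here refl) e
    (∣e∣ , cong length (filter-none (λ d → (d ⊆? e) ×-dec RGraph.Edge? H d)
      (All.universal (λ d (d⊆e , d-edge) →
        coclique d (RGraph.uniform H d d-edge) (λ x∈ → e⊆S (d⊆e x∈)) d-edge) (subsets n))))

∣S∣≤h : ∀ {r} (H : RGraph r n) {S} → Homogeneous H S → ∣ S ∣ ≤ h H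
∣S∣≤h H {S} hom = v≤max⁺ 0 _ (inj₂ (Any.map (λ { refl → ≤-refl })
  (∈-map⁺ ∣_∣ (∈-filter⁺ (homogeneous? H) (∈-subsets S) hom))))

h≤ : ∀ {r} (H : RGraph r n) → (∀ S → Homogeneous H S → ∣ S ∣ ≤ k) → h H ≤ k
h≤ H bound = max≤v⁺ z≤n (All.map⁺ (All.map (λ {S} → bound S)
  (All.all-filter (homogeneous? H) (subsets _))))

-- Cocliques have at most three vertices, so for `3 ≤ k` the bound on cliques bounds all homogeneous
-- sets.
minimum-of-cliques : (H : RGraph 3 n) → QFree H Forbidden →
  (∀ S → Clique H S → ∣ S ∣ ≤ k) → 3 ≤ k →
  (∀ H′ → QFree H′ Forbidden → ∃[ S ] (Clique H′ S × k ≤ ∣ S ∣)) → h[ 3 ] n , Forbidden ≔ k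
minimum-of-cliques {k = k} H free upper 3≤k lower =
  (H , free , ≤-antisym (h≤ H hom≤k) (lower′ H free)) ,
  λ { j (H′ , free′ , refl) → lower′ H′ free′ }
  where
  hom≤k : ∀ S → Homogeneous H S → ∣ S ∣ ≤ k
  hom≤k S (inj₁ clique)   = upper S clique
  hom≤k S (inj₂ coclique) = ≤-trans (coclique≤3 H free S coclique) 3≤k

  lower′ : ∀ H′ → QFree H′ Forbidden → k ≤ h H′
  lower′ H′ free′ = let S , clique , k≤∣S∣ = lower H′ free′ in
    ≤-trans k≤∣S∣ (∣S∣≤h H′ (inj₁ clique))

n<2s⇒1+⌊n/2⌋≤s : ∀ n s → n < 2 * s → suc ⌊ n /2⌋ ≤ s
n<2s⇒1+⌊n/2⌋≤s n s n<2s = begin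
  -- `⌈ suc n /2⌉` unfolds to `suc ⌊ n /2⌋`.
  ⌈ suc n /2⌉  ≤⟨ ⌈n/2⌉-mono n<2s ⟩
  ⌈ 2 * s /2⌉  ≡⟨ cong (λ t → ⌈ s + t /2⌉) (+-identityʳ s) ⟩
  ⌈ s + s /2⌉  ≡⟨ n≡⌈n+n/2⌉ s ⟨
  s            ∎
  where open ≤-Reasoning

h-multiple-of-6 : ∀ k → h[ 3 ] (suc k * 6) , Forbidden ≔ (suc k * 3)
h-multiple-of-6 k = minimum-of-cliques (blowup (suc k * 6))
  (wordGraph-free mod6 evenWord blowup-four)
  (λ S clique → blowupClique-bound (suc k) S (clique⇒TriplesIn mod6 evenWord clique))
  (s≤s (s≤s (s≤s z≤n)))
  λ H free → let S , clique , heavy = large-clique H free in S , clique , half heavy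
  where
  6k≡2*3k : ∀ k → k * 6 ≡ 2 * (k * 3)
  6k≡2*3k = solve-∀

  half : ∀ {s} → Heavy (suc k * 6) s → suc k * 3 ≤ s
  half {s} heavy = *-cancelˡ-≤ 2 (subst (_≤ 2 * s) (6k≡2*3k (suc k)) (weaken heavy))
    where
    weaken : Heavy (suc k * 6) s → suc k * 6 ≤ 2 * s
    weaken (inj₁ n<2s)       = <⇒≤ n<2s
    weaken (inj₂ (_ , n≤2s)) = n≤2s

h-not-multiple-of-6 : ∀ m → 4 ≤ suc m → suc m % 6 ≢ 0 →
  h[ 3 ] suc m , Forbidden ≔ suc ⌊ suc m /2⌋
h-not-multiple-of-6 m 4≤n n%6≢0 = minimum-of-cliques (signGraph (suc m))
  (wordGraph-free sign nonalternating signGraph-four)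
  (λ S clique → signClique-bound S (clique⇒TriplesIn sign nonalternating clique))
  -- At least four vertices make the half at least 2, hence the bound at least 3, the largest size
  -- of a coclique.
  (s≤s (⌊n/2⌋-mono 4≤n))
  λ H free → let S , clique , heavy = large-clique H free in S , clique , half heavy
  where
  half : ∀ {s} → Heavy (suc m) s → suc ⌊ suc m /2⌋ ≤ s
  half {s} (inj₁ n<2s)       = n<2s⇒1+⌊n/2⌋≤s (suc m) s n<2s
  half     (inj₂ (n%6≡0 , _)) = contradiction n%6≡0 n%6≢0

mainTheorem11 : (n : ℕ) → 4 ≤ n →
    let Q = _∈ ((4 , 0) ∷ (4 , 1) ∷ (4 , 3) ∷ []) in
    (n % 6 ≡ 0 → h[ 3 ] n , Q ≔ (n / 2))
    × (n % 6 ≢ 0 → h[ 3 ] n , Q ≔ ⌈ n + 1 /2⌉)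
mainTheorem11 n@(suc m) 4≤n = multiple , other
  where
  other : n % 6 ≢ 0 → h[ 3 ] n , Forbidden ≔ ⌈ n + 1 /2⌉
  other n%6≢0 = subst (λ l → h[ 3 ] n , Forbidden ≔ ⌈ l /2⌉) (+-comm 1 n)
    (h-not-multiple-of-6 m 4≤n n%6≢0)

  multiple : n % 6 ≡ 0 → h[ 3 ] n , Forbidden ≔ (n / 2)
  multiple n%6≡0 = go (n / 6) (trans (m≡m%n+[m/n]*n n 6) (cong (_+ n / 6 * 6) n%6≡0))
    where
    go : ∀ q → n ≡ q * 6 → h[ 3 ] n , Forbidden ≔ (n / 2)
    -- The quotient is positive because `n` is.
    go (suc k) n≡6q = subst (λ l → h[ 3 ] l , Forbidden ≔ (l / 2)) (sym n≡6q)
      (subst (h[ 3 ] suc k * 6 , Forbidden ≔_) half (h-multiple-of-6 k))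
      where
      half : suc k * 3 ≡ suc k * 6 / 2
      half = trans (sym (m*n/n≡m (suc k * 3) 2)) (cong (_/ 2) (*-assoc (suc k) 3 2))
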